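{- For every order frame $\langle W,<\rangle$: the schema Flattening, $(p>((p\wedge q)>r))\leftrightarrow((p\wedge q)>r)$, is valid on $\langle W,<\rangle$ if and only if $\langle W,<\rangle$ is flat.
   Context: Language. Let $At=\{p_0,p_1,\ldots\}$ be a countably infinite set of atoms. $\mathcal{L}_>$ is generated by $p ::= p_k\in At\mid \neg p\mid (p\wedge p)\mid (p>p)$; $\vee,\to,\leftrightarrow$ are defined as usual. Order frames and models. An order frame is a pair $\langle W,<\rangle$ where $W\neq\varnothing$ and $<$ is a function taking each $w\in W$ to a strict well-order $<_w$ on some subset of $W$ such that whenever $x<_w y$, either $w=x$ or $w<_w x$. Its accessibility relation is $R(w)=\{w\}\cup\{v: w<_w v\}$ (write $wRv$ for $v\in R(w)$). An order model $\langle W,<,V\rangle$ adds a valuation $V:At\times W\to\{0,1\}$; put $V(p_k)=\{w:V(p_k,w)=1\}$. Denotations: $[\![p_k]\!]=V(p_k)$, $[\![\neg p]\!]=W\setminus[\![p]\!]$, $[\![p\wedge q]\!]=[\![p]\!]\cap[\![q]\!]$, and $w\in[\![p>q]\!]$ iff either $R(w)\cap[\![p]\!]=\varnothing$, or there is $y\in R(w)\cap[\![p]\!]\cap[\![q]\!]$ such that $x\notin[\![p]\!]$ whenever $x<_w y$. A sentence $p$ is true at $w$ iff $w\in[\![p]\!]$. A schema is valid on an order frame iff each of its instances in $\mathcal{L}_>$ is true at every $w\in W$ in every order model based on that frame. An order frame is semi-flat iff whenever $x<_w y$, we have $y\in R(x)$ and, for all $z$ such that $y<_w z$ or $z\in R(x)\setminus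 R(w)$, $y<_x z$. It is flat iff it is semi-flat and its accessibility relation $R$ is transitive. -}

module Defs where

open import Data.Bool using (Bool; true)
open import Data.Nat using (ℕ)
open import Data.Product using (_×_; ∃; proj₁)
open import Data.Sum using (_⊎_)
open import Function using (_on_)
open import Induction.WellFounded using (WellFounded)
open import Level using (Level; Lift; suc; 0ℓ)
open import Relation.Binary using (Rel; IsStrictTotalOrder; Transitive)
open import Relation.Binary.PropositionalEquality using (_≡_)
open import Relation.Unary using (Pred; _∈_; _∉_; _∩_; _∪_; ∁; Empty; ｛_｝)

private
  variable
    ℓ : Level

infix  9 ~_
infixr 8 _∧_
infixr 7 _>_
infixr 6 _⟶_
infix  5 _⟷_

data Sentence : Set where
  atom : ℕ → Sentence
  ~_   : Sentence → Sentence
  _∧_  : Sentence → Sentence → Sentence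
  _>_  : Sentence → Sentence → Sentence

_⟶_ : Sentence → Sentence → Sentence
p ⟶ q = ~ (p ∧ ~ q)

_⟷_ : Sentence → Sentence → Sentence
p ⟷ q = (p ⟶ q) ∧ (q ⟶ p)

-- A schema is identified with the set of its instances.
Schema : Set₁
Schema = Pred Sentence 0ℓ

data Flattening : Schema where
  flattening : ∀ p q r → Flattening ((p > ((p ∧ q) > r)) ⟷ ((p ∧ q) > r))

-- _≺_ is a strict well-order on the subset D of W.  The order laws are stated
-- on the subtype ∃ D, where elements are compared by their underlying point of
-- W, so that proofs of membership in D are irrelevant.
record IsStrictWellOrderOn {W : Set ℓ} (D : Pred W ℓ) (_≺_ : Rel W ℓ) : Set ℓ where
  field
    supported          : ∀ {x y} → x ≺ y → x ∈ D × y ∈ D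
    isStrictTotalOrder : IsStrictTotalOrder {A = ∃ D} (_≡_ on proj₁) (_≺_ on proj₁)
    wellFounded        : WellFounded {A = ∃ D} (_≺_ on proj₁)

-- The subset ordered by <_w is the field dom w.
record OrderFrame (ℓ : Level) : Set (suc ℓ) where
  field
    W                   : Set ℓ
    nonempty            : W
    -- x <[ w ] y stands for x <_w y.
    _<[_]_              : W → W → W → Set ℓ
    dom                 : W → Pred W ℓ
    isStrictWellOrderOn : ∀ w → IsStrictWellOrderOn (dom w) (λ x y → x <[ w ] y)
    centred             : ∀ {w x y} → x <[ w ] y → w ≡ x ⊎ w <[ w ] x

  R : W → Pred W ℓ
  R w = ｛ w ｝ ∪ (λ v → w <[ w ] v)

  Valuation : Set ℓ
  Valuation = ℕ → W → Bool

  module _ (V : Valuation) where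

    ⟦_⟧ : Sentence → Pred W ℓ
    ⟦ atom k ⟧   = λ w → Lift ℓ (V k w ≡ true)
    ⟦ ~ p ⟧      = ∁ ⟦ p ⟧
    ⟦ p ∧ q ⟧    = ⟦ p ⟧ ∩ ⟦ q ⟧
    ⟦ p > q ⟧    = λ w →
      Empty (R w ∩ ⟦ p ⟧) ⊎
      ∃ λ y → y ∈ R w ∩ ⟦ p ⟧ ∩ ⟦ q ⟧ × (∀ {x} → x <[ w ] y → x ∉ ⟦ p ⟧)

  Valid : Schema → Set ℓ
  Valid S = ∀ {p} → p ∈ S → ∀ V w → w ∈ ⟦_⟧ V p

  SemiFlat : Set ℓ
  SemiFlat = ∀ {w x y} → x <[ w ] y →
    y ∈ R x × (∀ {z} → (y <[ w ] z) ⊎ (z ∈ R x × z ∉ R w) → y <[ x ] z)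

  Flat : Set ℓ
  Flat = SemiFlat × Transitive R

{-# OPTIONS --safe #-}

-- Flattening says that a conditional S > T with S = P ∩ Q has the same truth
-- value at w as at the w-closest P-world x.  Since P can be taken to be {x} ∪ S
-- and Q to be S, validity amounts to S > T not changing its truth value between
-- w and any x ∈ R(w) such that no S-world is <_w-below x (`Shift`).  In a flat
-- frame the least S-world of w is also that of x, whence `Shift`.  Conversely,
-- S = {y} and T = ∅ show that w and x agree on the accessibility of any y that is
-- not <_w-below x, and for x <_w y <_w z the choice S = {y , z}, T = {y} gives
-- y <_x z.
module Submission where

open import Defs
open import Axiom.ExcludedMiddle using (ExcludedMiddle)
open import Data.Bool using (Bool; true)
open import Data.Empty using (⊥-elim)
open import Data.Empty.Polymorphic using () renaming (⊥ to ⊥ₗ)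
open import Data.Product using (_×_; _,_; ∃; proj₁; proj₂)
open import Data.Sum using (_⊎_; inj₁; inj₂)
open import Function.Bundles using (_⇔_; mk⇔; Equivalence)
open import Function.Construct.Composition using (_⇔-∘_)
open import Function.Construct.Symmetry using (⇔-sym)
open import Induction.WellFounded using (Acc; acc)
open import Level using (Lift; lift; suc)
open import Relation.Binary using (IsStrictTotalOrder; Transitive; Tri; tri<; tri≈; tri>)
open import Relation.Binary.PropositionalEquality using (_≡_; refl)
open import Relation.Nullary using (¬_; yes; no; does)
open import Relation.Nullary.Decidable using (dec-true; decidable-stable)
open import Relation.Unary using (Pred; _∈_; _∉_; _⊆_; _≐_; _∩_; _∪_; Empty; ｛_｝)

open Equivalence using (to; from)

module _ {ℓ} (F : OrderFrame ℓ) where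
  open OrderFrame F

  private
    module Ord w = IsStrictWellOrderOn (isStrictWellOrderOn w)
    module STO w = IsStrictTotalOrder (Ord.isStrictTotalOrder w)

  -- Accessible points under a single order.

  <-irrefl : ∀ {w x} → ¬ x <[ w ] x
  <-irrefl {w} x<x with Ord.supported w x<x
  ... | dx , _ = STO.irrefl w {_ , dx} {_ , dx} refl x<x

  <-trans : ∀ {w x y z} → x <[ w ] y → y <[ w ] z → x <[ w ] z
  <-trans {w} x<y y<z with Ord.supported w x<y | Ord.supported w y<z
  ... | dx , dy | _ , dz = STO.trans w {_ , dx} {_ , dy} {_ , dz} x<y y<z

  <-asym : ∀ {w x y} → x <[ w ] y → ¬ y <[ w ] x
  <-asym x<y y<x = <-irrefl (<-trans x<y y<x)

  centre-minimal : ∀ {w x} → ¬ x <[ w ] w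
  centre-minimal x<w with centred x<w
  ... | inj₁ refl = <-irrefl x<w
  ... | inj₂ w<x  = <-asym x<w w<x

  <⇒∈Rˡ : ∀ {w x y} → x <[ w ] y → x ∈ R w
  <⇒∈Rˡ = centred

  <⇒∈Rʳ : ∀ {w x y} → x <[ w ] y → y ∈ R w
  <⇒∈Rʳ x<y with centred x<y
  ... | inj₁ refl = inj₂ x<y
  ... | inj₂ w<x  = inj₂ (<-trans w<x x<y)

  -- The centre `w` need not lie in `dom w`, so totality of the order is used only between points
  -- above `w`; the centre lies below all of these.
  R-compare : ∀ {w x y} → x ∈ R w → y ∈ R w → Tri (x <[ w ] y) (x ≡ y) (y <[ w ] x)
  R-compare (inj₁ refl) (inj₁ refl) = tri≈ <-irrefl refl <-irrefl
  R-compare (inj₁ refl) (inj₂ w<y)  = tri< w<y (λ { refl → <-irrefl w<y }) centre-minimal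
  R-compare (inj₂ w<x)  (inj₁ refl) = tri> centre-minimal (λ { refl → <-irrefl w<x }) w<x
  R-compare {w} (inj₂ w<x) (inj₂ w<y) =
    STO.compare w (_ , proj₂ (Ord.supported w w<x)) (_ , proj₂ (Ord.supported w w<y))

  -- Least accessible points and the conditional.

  IsLeast : W → Pred W ℓ → W → Set ℓ
  IsLeast w P y = y ∈ R w × y ∈ P × (∀ {x} → x <[ w ] y → x ∉ P)

  IsLeast-unique : ∀ {w P x y} → IsLeast w P x → IsLeast w P y → x ≡ y
  IsLeast-unique (Rx , Px , minx) (Ry , Py , miny) with R-compare Rx Ry
  ... | tri< x<y _ _ = ⊥-elim (miny x<y Px)
  ... | tri≈ _ x≡y _ = x≡y
  ... | tri> _ _ y<x = ⊥-elim (minx y<x Py)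

  centre-least : ∀ {w P} → w ∈ P → IsLeast w P w
  centre-least Pw = inj₁ refl , Pw , λ x<w _ → centre-minimal x<w

  -- The clause for `_>_` with arbitrary predicates as denotations, so that `⟦_⟧ V (p > q)` unfolds
  -- to it.
  Cond : Pred W ℓ → Pred W ℓ → Pred W ℓ
  Cond P Q w =
    Empty (R w ∩ P) ⊎ ∃ λ y → y ∈ R w ∩ P ∩ Q × (∀ {x} → x <[ w ] y → x ∉ P)

  Cond-mono : ∀ {P P′ Q Q′} → P ≐ P′ → Q ⊆ Q′ → Cond P Q ⊆ Cond P′ Q′
  Cond-mono (_ , P′⊆P) _ (inj₁ none) = inj₁ λ y (Ry , P′y) → none y (Ry , P′⊆P P′y)
  Cond-mono (P⊆P′ , P′⊆P) Q⊆Q′ (inj₂ (y , (Ry , Py , Qy) , min)) =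
    inj₂ (y , (Ry , P⊆P′ Py , Q⊆Q′ Qy) , λ x<y P′x → min x<y (P′⊆P P′x))

  Cond-cong : ∀ {P P′ Q Q′} → P ≐ P′ → Q ≐ Q′ → ∀ {w} → Cond P Q w ⇔ Cond P′ Q′ w
  Cond-cong (P⊆P′ , P′⊆P) (Q⊆Q′ , Q′⊆Q) =
    mk⇔ (Cond-mono (P⊆P′ , P′⊆P) Q⊆Q′) (Cond-mono (P′⊆P , P⊆P′) Q′⊆Q)

  Cond-least : ∀ {w P x} → IsLeast w P x → ∀ Q → Cond P Q w ⇔ x ∈ Q
  Cond-least {w} {P} {x} least@(Rx , Px , min) Q = mk⇔ ⇒ λ Qx → inj₂ (x , (Rx , Px , Qx) , min)
    where
    ⇒ : Cond P Q w → x ∈ Q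
    ⇒ (inj₁ none) = ⊥-elim (none x (Rx , Px))
    ⇒ (inj₂ (y , (Ry , Py , Qy) , miny)) with IsLeast-unique least (Ry , Py , miny)
    ... | refl = Qy

  Cond-empty : ∀ {w x P Q} → Empty (R w ∩ P) → Empty (R x ∩ P) → Cond P Q w ⇔ Cond P Q x
  Cond-empty nonew nonex = mk⇔ (λ _ → inj₁ nonex) (λ _ → inj₁ nonew)

  -- `Shift` and flatness.

  Shift : Set (suc ℓ)
  Shift = ∀ S T {w x} → x ∈ R w → (∀ {s} → s <[ w ] x → s ∉ S) → Cond S T w ⇔ Cond S T x

  -- An impossible consequent leaves only the vacuous case, so this conditional detects
  -- accessibility of `y`.
  Cond-｛｝-⊥ : ∀ {v y} → Cond ｛ y ｝ (λ _ → ⊥ₗ) v ⇔ y ∉ R v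
  Cond-｛｝-⊥ {v} {y} = mk⇔ ⇒ λ ∉R → inj₁ λ { _ (Ry , refl) → ∉R Ry }
    where
    ⇒ : Cond ｛ y ｝ (λ _ → ⊥ₗ) v → y ∉ R v
    ⇒ (inj₁ none) Ry = none y (Ry , refl)
    ⇒ (inj₂ (_ , (_ , _ , ()) , _))

  module _ (em : ExcludedMiddle ℓ) where

    least-exists : ∀ {w P v} → v ∈ R w → v ∈ P → ∃ (IsLeast w P)
    least-exists (inj₁ refl) Pw = _ , centre-least Pw
    least-exists {w} {P} (inj₂ w<v) Pv =
      go (Ord.wellFounded w (_ , proj₂ (Ord.supported w w<v))) (inj₂ w<v) Pv
      where
      go : ∀ {v} → Acc _ v → proj₁ v ∈ R w → proj₁ v ∈ P → ∃ (IsLeast w P)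
      go {v , _} (acc rs) Rv Pv with em {∃ λ u → u <[ w ] v × u ∈ P}
      ... | yes (u , u<v , Pu) = go (rs {u , proj₁ (Ord.supported w u<v)} u<v) (<⇒∈Rˡ u<v) Pu
      ... | no none = v , Rv , Pv , λ u<v Pu → none (_ , u<v , Pu)

    empty-or-least : ∀ w P → Empty (R w ∩ P) ⊎ ∃ (IsLeast w P)
    empty-or-least w P with em {∃ (R w ∩ P)}
    ... | yes (_ , Rv , Pv) = inj₂ (least-exists Rv Pv)
    ... | no none = inj₁ λ v RPv → none (v , RPv)

    -- The hypothesis `¬ y <[ w ] x` is the side condition of `Shift` for `｛ y ｝`. What gets
    -- transferred is inaccessibility, hence the double negations.
    accessible-transfer : Shift → ∀ {w x y} → x ∈ R w → ¬ y <[ w ] x → y ∈ R w ⇔ y ∈ R x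
    accessible-transfer shift {w} {x} {y} Rx y≮x = mk⇔
      (λ Rwy → decidable-stable em λ ∉Rx → to Cond-｛｝-⊥ (from shifted (from Cond-｛｝-⊥ ∉Rx)) Rwy)
      (λ Rxy → decidable-stable em λ ∉Rw → to Cond-｛｝-⊥ (to shifted (from Cond-｛｝-⊥ ∉Rw)) Rxy)
      where
      shifted : Cond ｛ y ｝ (λ _ → ⊥ₗ) w ⇔ Cond ｛ y ｝ (λ _ → ⊥ₗ) x
      shifted = shift ｛ y ｝ (λ _ → ⊥ₗ) Rx λ { s<x refl → y≮x s<x }

    shift⇒transitive : Shift → Transitive R
    shift⇒transitive shift {w} {x} {y} Rwx Rxy with em {y <[ w ] x}
    ... | yes y<x = <⇒∈Rˡ y<x
    ... | no y≮x = from (accessible-transfer shift Rwx y≮x) Rxy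

    shift⇒order : Shift → ∀ {w x y z} → x <[ w ] y → y <[ w ] z → y <[ x ] z
    shift⇒order shift {w} {x} {y} {z} x<y y<z = y<ₓz
      where
      S : Pred W ℓ
      S = ｛ y ｝ ∪ ｛ z ｝

      x<z : x <[ w ] z
      x<z = <-trans x<y y<z

      least-w : IsLeast w S y
      least-w = <⇒∈Rʳ x<y , inj₁ refl ,
        λ { u<y (inj₁ refl) → <-irrefl u<y ; u<y (inj₂ refl) → <-asym u<y y<z }

      -- This rules out vacuous truth of the conditional at `x` and makes `y` and `z` comparable
      -- there.
      Rxz : z ∈ R x
      Rxz = to (accessible-transfer shift (<⇒∈Rˡ x<y) (<-asym x<z)) (<⇒∈Rʳ x<z)

      cond-x : Cond S ｛ y ｝ x
      cond-x = to
        (shift S ｛ y ｝ (<⇒∈Rˡ x<y)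
          λ { u<x (inj₁ refl) → <-asym x<y u<x ; u<x (inj₂ refl) → <-asym x<z u<x })
        (from (Cond-least least-w ｛ y ｝) refl)

      y<ₓz : y <[ x ] z
      y<ₓz with cond-x
      ... | inj₁ none = ⊥-elim (none z (Rxz , inj₂ refl))
      ... | inj₂ (_ , (Rxy , _ , refl) , min) with R-compare Rxy Rxz
      ...   | tri< y<ₓz _ _ = y<ₓz
      ...   | tri≈ _ refl _ = ⊥-elim (<-irrefl y<z)
      ...   | tri> _ _ z<ₓy = ⊥-elim (min z<ₓy (inj₂ refl))

    shift⇒flat : Shift → Flat
    shift⇒flat shift = semiFlat , shift⇒transitive shift
      where
      semiFlat : SemiFlat
      semiFlat x<y =
        to (accessible-transfer shift (<⇒∈Rˡ x<y) (<-asym x<y)) (<⇒∈Rʳ x<y) ,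
        λ { (inj₁ y<z) → shift⇒order shift x<y y<z
          -- Transitivity gives `R x ⊆ R w`, so this alternative never arises.
          ; (inj₂ (Rxz , ∉Rw)) → ⊥-elim (∉Rw (shift⇒transitive shift (<⇒∈Rˡ x<y) Rxz)) }

    flat⇒shift : Flat → Shift
    flat⇒shift (semiFlat , R-trans) S T {w} {x} Rx below∉S with empty-or-least w S
    ... | inj₁ none = Cond-empty none λ v (Rxv , Sv) → none v (R-trans Rx Rxv , Sv)
    ... | inj₂ (y , least@(Ry , Sy , min)) =
      ⇔-sym (Cond-least least-x T) ⇔-∘ Cond-least least T
      where
      least-x : IsLeast x S y
      least-x with R-compare Rx Ry
      ... | tri> _ _ y<x = ⊥-elim (below∉S y<x Sy)
      ... | tri≈ _ refl _ = centre-least Sy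
      ... | tri< x<y _ _ = proj₁ (semiFlat x<y) , Sy , min-x
        where
        min-x : ∀ {z} → z <[ x ] y → z ∉ S
        -- By transitivity `z` is in `R w`, so it can be compared with `y` at `w`; if it came after
        -- `y` there, semi-flatness would put it after `y` at `x` too.
        min-x z<ₓy Sz with R-compare (R-trans Rx (<⇒∈Rˡ z<ₓy)) Ry
        ... | tri< z<y _ _ = min z<y Sz
        ... | tri≈ _ refl _ = <-irrefl z<ₓy
        ... | tri> _ _ y<z = <-asym z<ₓy (proj₂ (semiFlat x<y) (inj₁ y<z))

    -- `Shift` and validity.

    ⟷-⇔ : ∀ V p q {w} → w ∈ ⟦_⟧ V (p ⟷ q) ⇔ (w ∈ ⟦_⟧ V p ⇔ w ∈ ⟦_⟧ V q)
    ⟷-⇔ V p q = mk⇔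
      (λ (p⟶q , q⟶p) → mk⇔ (λ a → decidable-stable em λ ¬b → p⟶q (a , ¬b))
                           (λ b → decidable-stable em λ ¬a → q⟶p (b , ¬a)))
      (λ e → (λ (a , ¬b) → ¬b (to e a)) , (λ (b , ¬a) → ¬a (from e b)))

    shift⇒valid : Shift → Valid Flattening
    shift⇒valid shift (flattening p q r) V w =
      from (⟷-⇔ V (p > ((p ∧ q) > r)) ((p ∧ q) > r)) equivalent
      where
      P S C : Pred W ℓ
      P = ⟦_⟧ V p
      S = ⟦_⟧ V (p ∧ q)
      C = ⟦_⟧ V ((p ∧ q) > r)

      equivalent : Cond P C w ⇔ C w
      equivalent with empty-or-least w P
      ... | inj₁ none = mk⇔ (λ _ → inj₁ λ v (Rv , Pv , _) → none v (Rv , Pv)) (λ _ → inj₁ none)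
      ... | inj₂ (x , least@(Rx , _ , min)) =
        -- Every `S`-world is a `P`-world, so none lies below the least `P`-world `x`, and `Shift`
        -- applies.
        ⇔-sym (shift S (⟦_⟧ V r) Rx λ s<x (Ps , _) → min s<x Ps) ⇔-∘ Cond-least least C

    -- Valuations are Boolean; excluded middle lets an atom denote any given predicate.
    char : Pred W ℓ → W → Bool
    char P v = does (em {P v})

    char-≐ : ∀ P → (λ v → Lift ℓ (char P v ≡ true)) ≐ P
    char-≐ P = ⊆ , λ {v} Pv → lift (dec-true (em {P v}) Pv)
      where
      ⊆ : ∀ {v} → Lift ℓ (char P v ≡ true) → P v
      ⊆ {v} (lift eq) with em {P v}
      ⊆ (lift refl) | yes Pv = Pv

    valid⇒shift : Valid Flattening → Shift
    valid⇒shift valid S T {w} {x} Rx below∉S =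
      -- Read from right to left, the chain runs from `Cond S T w` through `C w`,
      -- `Cond (⟦_⟧ V p) C w` and `C x` to `Cond S T x`.
      (Cond-cong PQ≐S T≐ ⇔-∘ Cond-least least C) ⇔-∘
      (⇔-sym flattened ⇔-∘ ⇔-sym (Cond-cong PQ≐S T≐))
      where
      V : Valuation
      -- Adding `x` to `S` makes `x` the least `p`-world at `w`, while `p ∧ q` still denotes `S`.
      V 0 = char (｛ x ｝ ∪ S)
      V 1 = char S
      V _ = char T

      p q r : Sentence
      p = atom 0
      q = atom 1
      r = atom 2

      C : Pred W ℓ
      C = ⟦_⟧ V ((p ∧ q) > r)

      P≐ : ⟦_⟧ V p ≐ ｛ x ｝ ∪ S
      P≐ = char-≐ _

      Q≐ : ⟦_⟧ V q ≐ S
      Q≐ = char-≐ S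

      T≐ : ⟦_⟧ V r ≐ T
      T≐ = char-≐ T

      PQ≐S : ⟦_⟧ V (p ∧ q) ≐ S
      PQ≐S = (λ (_ , Qv) → proj₁ Q≐ Qv) , λ Sv → proj₂ P≐ (inj₂ Sv) , proj₂ Q≐ Sv

      least : IsLeast w (⟦_⟧ V p) x
      least = Rx , proj₂ P≐ (inj₁ refl) , λ u<x Pu → below u<x (proj₁ P≐ Pu)
        where
        below : ∀ {u} → u <[ w ] x → u ∉ ｛ x ｝ ∪ S
        below u<x (inj₁ refl) = <-irrefl u<x
        below u<x (inj₂ Su)   = below∉S u<x Su

      flattened : Cond (⟦_⟧ V p) C w ⇔ C w
      flattened = to (⟷-⇔ V (p > ((p ∧ q) > r)) ((p ∧ q) > r)) (valid (flattening p q r) V w)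

theorem4p3 : ∀ {ℓ} → ExcludedMiddle ℓ → (F : OrderFrame ℓ) →
    OrderFrame.Valid F Flattening ⇔ OrderFrame.Flat F
theorem4p3 em F =
  mk⇔ (λ (valid : OrderFrame.Valid F Flattening) → shift⇒flat F em (valid⇒shift F em valid))
      (λ flat → shift⇒valid F em (flat⇒shift F em flat))
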